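{- Let $G$ be a finite simple graph of order $n$ with $m$ edges and minimum degree $\delta$, let $k\geq 0$ and $t\geq 1$ be integers, $h=k+1$ and $s=\mathrm{sp}(G,k)$. Let $n_j$ be the number of vertices of degree $j$ in $G$, and for $i\ge 0$ let $W_i=\sum_{j=\delta+ih}^{\delta+ih+k}n_j$. (i) Equality holds in the inequality $$\mathrm{sp}(G,k)\ \geq\ \frac{2\left( n(\delta+th)-2m+\sum_{v\in V(G)}\varepsilon_{t}(\deg(v))\right)}{h\,t(t+1)}$$ if and only if $W_0=W_1=\cdots=W_{t-1}=s$. (ii) Equality holds in the inequality $\mathrm{sp}(G,k)\geq f_t$, that is $s=f_t$, if and only if every degree of $G$ lies in $\{\delta,\delta+h,\ldots,\delta+th\}$ and $$n_\delta=n_{\delta+h}=\cdots=n_{\delta+(t-1)h}=s,\qquad n_{\delta+th}=n-ts\leq s.$$ In particular, equality forces $s=f_t$ to be an integer with $n/(t+1)\leq s\leq n/t$, and $t-1\leq 2x\leq t$.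
   Context: For a graph $G$ and $B\subseteq V(G)$ the spread is $\mathrm{sp}(B)=\max_{u\in B}\deg_G(u)-\min_{v\in B}\deg_G(v)$, and $\mathrm{sp}(G,k)$ is the largest cardinality of a set $B\subseteq V(G)$ with $\mathrm{sp}(B)\leq k$. For $i\geq 0$ let $I_i=\{\delta+ih,\ldots,\delta+ih+k\}$, and let $\mu(y,i)=1$ if $y\in I_i$ and $0$ otherwise. For integers $t\ge1$, $y\geq\delta$ put $u_t(y)=\sum_{i=0}^{t-1}(t-i)\mu(y,i)$ and $\varepsilon_t(y)=h\,u_t(y)-(\delta+th-y)$. With $d=2m/n$ and $x=(d-\delta)/h$, $$f_t=f_t(n,m,\delta,k)=\frac{2\left(n(\delta+th)-2m\right)}{h\,t(t+1)}=\frac{2n(t-x)}{t(t+1)}.$$ Both inequalities in (i) and (ii) hold for every graph $G$. -}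

module Defs where

open import Data.Bool.Base using (if_then_else_)
open import Data.Fin.Base as Fin using (Fin; toℕ)
import Data.Fin.Properties as Fin
open import Data.Fin.Subset using (Subset; inside; outside; ⊤; ∣_∣)
open import Data.Fin.Subset.Properties using (_∈?_)
open import Data.Integer.Base as ℤ using (ℤ; +_)
import Data.Integer.Properties as ℤ
open import Data.List.Base
  using (List; []; _∷_; [_]; _++_; map; filter; length; allFin; cartesianProduct)
open import Data.List.Extrema.Nat using (max; min)
open import Data.Nat.Base
open import Data.Nat.Properties using (_≟_; _≤?_; +-0-commutativeMonoid; m*n≢0)
open import Data.Product.Base using (_×_; _,_; proj₁; proj₂)
open import Data.Rational.Base as ℚ using (ℚ)
open import Data.Vec.Base using ([]; _∷_)
open import Level using (0ℓ)
open import Relation.Binary.Core using (Rel)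
open import Relation.Binary.Definitions using (Decidable; Irreflexive; Symmetric)
open import Relation.Binary.PropositionalEquality.Core using (_≡_)
open import Relation.Nullary.Decidable using (does; _×-dec_)

import Algebra.Properties.CommutativeMonoid.Sum +-0-commutativeMonoid as ℕ-Sum
import Algebra.Properties.CommutativeMonoid.Sum ℤ.+-0-commutativeMonoid as ℤ-Sum

record Graph (n : ℕ) : Set₁ where
  field
    _~_      : Rel (Fin n) 0ℓ
    _~?_     : Decidable _~_
    ~-sym    : Symmetric _~_
    ~-irrefl : Irreflexive _≡_ _~_

module _ {n : ℕ} (G : Graph n) where
  open Graph G

  deg : Fin n → ℕ
  deg v = length (filter (v ~?_) (allFin n))

  -- Each edge is listed once, with its smaller endpoint first.
  edges : List (Fin n × Fin n)
  edges = filter (λ e → (proj₁ e Fin.<? proj₂ e) ×-dec (proj₁ e ~? proj₂ e))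
                 (cartesianProduct (allFin n) (allFin n))

  size : ℕ
  size = length edges

  degreesIn : Subset n → List ℕ
  degreesIn B = map deg (filter (_∈? B) (allFin n))

  maxDegreeIn : Subset n → ℕ
  maxDegreeIn B = max 0 (degreesIn B)

  -- `min` takes a default that competes with the list; the maximum never
  -- changes the minimum of a nonempty list.
  minDegreeIn : Subset n → ℕ
  minDegreeIn B = min (maxDegreeIn B) (degreesIn B)

  minDegree : ℕ
  minDegree = minDegreeIn ⊤

  -- The empty set gets spread 0. This does not affect `sp` below, since the
  -- empty set has cardinality 0.
  spread : Subset n → ℕ
  spread B = maxDegreeIn B ∸ minDegreeIn B

  numOfDegree : ℕ → ℕ
  numOfDegree j = length (filter (λ v → deg v ≟ j) (allFin n))

subsets : ∀ n → List (Subset n)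
subsets zero    = [ [] ]
subsets (suc n) = map (inside ∷_) (subsets n) ++ map (outside ∷_) (subsets n)

sp : ∀ {n} → Graph n → ℕ → ℕ
sp {n} G k = max 0 (map ∣_∣ (filter (λ B → spread G B ≤? k) (subsets n)))

module Intervals (δ k : ℕ) where

  h : ℕ
  h = suc k

  _∈I_ : ℕ → ℕ → Set
  y ∈I i = δ + i * h ≤ y × y ≤ δ + i * h + k

  _∈I?_ : Decidable _∈I_
  y ∈I? i = (δ + i * h ≤? y) ×-dec (y ≤? δ + i * h + k)

  μ : ℕ → ℕ → ℕ
  μ y i = if does (y ∈I? i) then 1 else 0

  u : ℕ → ℕ → ℕ
  u t y = ℕ-Sum.sum {t} λ i → (t ∸ toℕ i) * μ y (toℕ i)

  ε : ℕ → ℕ → ℤ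
  ε t y = + h ℤ.* + u t y ℤ.- (+ (δ + t * h) ℤ.- + y)

  -- The summation index r runs over 0, …, k, so that j = δ + ih + r.
  W : ∀ {n} → Graph n → ℕ → ℕ
  W G i = ℕ-Sum.sum {suc k} λ r → numOfDegree G (δ + i * h + toℕ r)

  denominator : ℕ → ℕ
  denominator t = h * (t * suc t)

  denominator≢0 : ∀ t .{{_ : NonZero t}} → NonZero (denominator t)
  denominator≢0 t = m*n≢0 h (t * suc t) {{_}} {{m*n≢0 t (suc t)}}

  module _ (n m : ℕ) where

    f : (t : ℕ) → .{{NonZero t}} → ℚ
    f t = (+ 2 ℤ.* (+ n ℤ.* + (δ + t * h) ℤ.- + (2 * m))) ℚ./ denominator t
      where instance _ = denominator≢0 t

    d : .{{NonZero n}} → ℚ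
    d = + (2 * m) ℚ./ n

    x : .{{NonZero n}} → ℚ
    x = (d ℚ.- + δ ℚ./ 1) ℚ.* (+ 1 ℚ./ h)

  refinedBound : ∀ {n} → Graph n → (t : ℕ) → .{{NonZero t}} → ℚ
  refinedBound {n} G t =
    (+ 2 ℤ.* (+ n ℤ.* + (δ + t * h) ℤ.- + (2 * size G)
              ℤ.+ ℤ-Sum.sum (λ v → ε t (deg G v))))
      ℚ./ denominator t
    where instance _ = denominator≢0 t

-- Writing y = δ + ih + r with r ≤ k, one has u_t(y) = t ∸ i, so ε_t(y) ≥ 0, with
-- equality exactly when y = δ + ih for some i ≤ t. By the handshake lemma, summing
-- h u_t(y) = (δ + th - y) + ε_t(y) over all degrees shows that the numerator in (i)
-- is 2h ∑_{i<t} (t - i) W_i. Each W_i is the size of a set of spread at most k, so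
-- W_i ≤ s, and ∑_{i<t} (t - i) = t(t + 1)/2 gives (i). Dropping the nonnegative ε
-- terms gives s ≥ f_t, with equality exactly when every ε_t vanishes and equality
-- holds in (i). In that case n = ts + W_t with 0 ≤ W_t ≤ s, and the bounds on s and
-- x follow.

module Submission where

open import Defs
open import Data.Bool.Base using (true; false; if_then_else_)
open import Data.Fin.Base as Fin using (Fin; zero; suc; toℕ; fromℕ<; punchIn)
import Data.Fin.Properties as Fin
open import Data.Fin.Subset as Subset using (Subset; inside; outside; ⊤; ∣_∣)
open import Data.Fin.Subset.Properties using (_∈?_; ∈⊤)
open import Data.Integer.Base as ℤ using (ℤ)
import Data.Integer.Properties as ℤ
import Data.Integer.Tactic.RingSolver as ℤ-Solver
open import Data.List.Base as List using (_++_; map; filter; length; allFin; cartesianProduct)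
open import Data.List.Extrema.Nat using (max≤v⁺; xs≤max; min≤xs; argmin-sel)
open import Data.List.Membership.Propositional using (_∈_)
open import Data.List.Membership.Propositional.Properties
  using (∈-allFin; ∈-filter⁺; ∈-filter⁻; ∈-map⁺; ∈-map⁻; ∈-++⁺ˡ; ∈-++⁺ʳ)
open import Data.List.Properties using (length-++; filter-++; map-tabulate)
open import Data.List.Relation.Unary.All as All using ()
open import Data.List.Relation.Unary.Any using (here)
open import Data.Nat.Base as ℕ hiding (_/_; _%_)
open import Data.Nat.DivMod using (m≡m%n+[m/n]*n; m%n<n)
open import Data.Nat.Properties
open import Data.Nat.Tactic.RingSolver using (solve-∀)
open import Data.Product.Base using (_×_; _,_; proj₁; proj₂; ∃-syntax)
open import Data.Rational.Base as ℚ using ()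
import Data.Rational.Properties as ℚ
open import Data.Rational.Unnormalised.Base as ℚᵘ using (ℚᵘ; mkℚᵘ; *≡*; *≤*)
import Data.Rational.Unnormalised.Properties as ℚᵘ
open import Data.Sum.Base using (inj₁; inj₂)
open import Data.Vec.Base as Vec using ([]; _∷_)
open import Data.Vec.Properties using ([]=⇒lookup; lookup∘tabulate)
open import Function.Base using (id; _∘_; case_of_)
open import Function.Bundles using (_⇔_; mk⇔; Equivalence)
open import Function.Construct.Composition using (_⇔-∘_)
open import Level using (0ℓ)
open import Relation.Binary.Definitions using (tri<; tri≈; tri>)
open import Relation.Binary.PropositionalEquality
open import Relation.Nullary using (Dec; does; yes; no; ¬_; contradiction; _×-dec_)
open import Relation.Unary using (Pred; Decidable)

open import Algebra.Properties.Semiring.Sum +-*-semiring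
import Algebra.Properties.CommutativeMonoid.Sum ℤ.+-0-commutativeMonoid as ℤ-Sum

private variable
  n : ℕ
  P Q : Set

-- Indicators and finite sums.

-- Chosen so that μ y i is 𝟙 (y ∈I? i) definitionally.
𝟙 : Dec P → ℕ
𝟙 P? = if does P? then 1 else 0

𝟙-yes : (P? : Dec P) → P → 𝟙 P? ≡ 1
𝟙-yes (yes _) _ = refl
𝟙-yes (no ¬p) p = contradiction p ¬p

𝟙-no : (P? : Dec P) → ¬ P → 𝟙 P? ≡ 0
𝟙-no (yes p) ¬p = contradiction p ¬p
𝟙-no (no _)  _  = refl

𝟙-cong : (P? : Dec P) (Q? : Dec Q) → (P → Q) → (Q → P) → 𝟙 P? ≡ 𝟙 Q?
𝟙-cong (yes p) Q? to from = sym (𝟙-yes Q? (to p))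
𝟙-cong (no ¬p) Q? to from = sym (𝟙-no Q? (¬p ∘ from))

sum-zero : (f : Fin n → ℕ) → (∀ i → f i ≡ 0) → sum f ≡ 0
sum-zero {n} f f≡0 = trans (sum-cong-≗ f≡0) (sum-replicate-zero n)

sum-point : (f : Fin n → ℕ) (i : Fin n) → (∀ j → j ≢ i → f j ≡ 0) → sum f ≡ f i
sum-point {suc n} f i f≡0 = begin
  sum f                            ≡⟨ sum-remove {i = i} f ⟩
  f i + sum (λ j → f (punchIn i j)) ≡⟨ cong (f i +_) (sum-zero _ λ j → f≡0 _ (Fin.punchInᵢ≢i i j)) ⟩
  f i + 0                          ≡⟨ +-identityʳ _ ⟩
  f i                              ∎
  where open ≡-Reasoning

sum-const : ∀ n c → sum {n} (λ _ → c) ≡ n * c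
sum-const zero    c = refl
sum-const (suc n) c = cong (c +_) (sum-const n c)

sum-mono-≤ : {f g : Fin n → ℕ} → (∀ i → f i ≤ g i) → sum f ≤ sum g
sum-mono-≤ {zero}  f≤g = z≤n
sum-mono-≤ {suc n} f≤g = +-mono-≤ (f≤g zero) (sum-mono-≤ (f≤g ∘ suc))

-- Cancelling the tail of `f` against the larger tail of `g` leaves `g zero ≤ f zero`. Both equality
-- analyses rest on this: once for the counts `W G i`, once for the vanishing of all ε terms.
sum-injective-≤ : {f g : Fin n → ℕ} → (∀ i → f i ≤ g i) → sum f ≡ sum g → ∀ i → f i ≡ g i
sum-injective-≤ {suc n} {f} {g} f≤g Σf≡Σg = λ where
    zero    → f₀≡g₀
    (suc i) → sum-injective-≤ (f≤g ∘ suc) Σf′≡Σg′ i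
  where
  f₀≡g₀ : f zero ≡ g zero
  f₀≡g₀ = ≤-antisym (f≤g zero) (+-cancelʳ-≤ (sum (f ∘ suc)) _ _
    (≤-trans (+-monoʳ-≤ (g zero) (sum-mono-≤ (f≤g ∘ suc))) (≤-reflexive (sym Σf≡Σg))))
  Σf′≡Σg′ : sum (f ∘ suc) ≡ sum (g ∘ suc)
  Σf′≡Σg′ = +-cancelˡ-≡ (f zero) _ _ (trans Σf≡Σg (cong (_+ sum (g ∘ suc)) (sym f₀≡g₀)))

sum-pos : (f : Fin n → ℕ) → ℤ-Sum.sum (λ i → ℤ.+ f i) ≡ ℤ.+ sum f
sum-pos {zero}  f = refl
sum-pos {suc n} f = cong (ℤ._+_ (ℤ.+ f zero)) (sum-pos (f ∘ suc))

-- Doubled to avoid a division. The weights are t, ..., 1, whence the factor t(t + 1) in both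
-- bounds.
triangular : ∀ t → 2 * sum {t} (λ i → t ∸ toℕ i) ≡ t * suc t
triangular zero    = refl
triangular (suc t) = begin
  2 * (suc t + sum {t} (λ i → t ∸ toℕ i))     ≡⟨ *-distribˡ-+ 2 (suc t) _ ⟩
  2 * suc t + 2 * sum {t} (λ i → t ∸ toℕ i)   ≡⟨ cong (2 * suc t +_) (triangular t) ⟩
  2 * suc t + t * suc t                       ≡⟨ ring t ⟩
  suc t * suc (suc t)                         ∎
  where
  open ≡-Reasoning
  ring : ∀ t → 2 * suc t + t * suc t ≡ suc t * suc (suc t)
  ring = solve-∀

-- Lengths of filtered lists as sums of indicators.

length-filter-tabulate : {A : Set} {P : Pred A 0ℓ} (P? : Decidable P) (f : Fin n → A) →
  length (filter P? (List.tabulate f)) ≡ sum (λ i → 𝟙 (P? (f i)))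
length-filter-tabulate {zero}  P? f = refl
length-filter-tabulate {suc n} P? f with does (P? (f zero))
... | true  = cong suc (length-filter-tabulate P? (f ∘ suc))
... | false = length-filter-tabulate P? (f ∘ suc)

-- The tabulated functions are arbitrary because the recursion passes from `f` to `f ∘ suc`;
-- `allFin` is the case of `id`.
length-filter-cartesianProduct :
  ∀ {m} {A B : Set} {P : Pred (A × B) 0ℓ} (P? : Decidable P) (f : Fin m → A) (g : Fin n → B) →
  length (filter P? (cartesianProduct (List.tabulate f) (List.tabulate g))) ≡
  sum (λ i → sum (λ j → 𝟙 (P? (f i , g j))))
length-filter-cartesianProduct {m = zero}  P? f g = refl
length-filter-cartesianProduct {m = suc m} P? f g = begin
  length (filter P? (row ++ rest))                      ≡⟨ cong length (filter-++ P? row rest) ⟩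
  length (filter P? row ++ filter P? rest)              ≡⟨ length-++ (filter P? row) ⟩
  length (filter P? row) + length (filter P? rest)
    ≡⟨ cong₂ _+_ (trans (cong (length ∘ filter P?) (map-tabulate g (f zero ,_)))
                        (length-filter-tabulate P? ((f zero ,_) ∘ g)))
                 (length-filter-cartesianProduct P? (f ∘ suc) g) ⟩
  sum (λ i → sum (λ j → 𝟙 (P? (f i , g j))))            ∎
  where
  open ≡-Reasoning
  row = map (f zero ,_) (List.tabulate g)
  rest = cartesianProduct (List.tabulate (f ∘ suc)) (List.tabulate g)

-- Subsets of the vertex set.

∈-subsets : (B : Subset n) → B ∈ subsets n
∈-subsets []            = here refl
∈-subsets (inside  ∷ B) = ∈-++⁺ˡ (∈-map⁺ (inside ∷_) (∈-subsets B))
∈-subsets (outside ∷ B) = ∈-++⁺ʳ _ (∈-map⁺ (outside ∷_) (∈-subsets B))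

comprehension : {P : Pred (Fin n) 0ℓ} → Decidable P → Subset n
comprehension P? = Vec.tabulate (does ∘ P?)

∣comprehension∣ : {P : Pred (Fin n) 0ℓ} (P? : Decidable P) →
  ∣ comprehension P? ∣ ≡ sum (λ v → 𝟙 (P? v))
∣comprehension∣ {zero}  P? = refl
∣comprehension∣ {suc n} P? with does (P? zero)
... | true  = cong suc (∣comprehension∣ (P? ∘ suc))
... | false = ∣comprehension∣ (P? ∘ suc)

∈-comprehension⁻ : {P : Pred (Fin n) 0ℓ} (P? : Decidable P) →
  ∀ {v} → v Subset.∈ comprehension P? → P v
-- The second scrutinee proves `does (P? v) ≡ true`, which rules out the `no` case.
∈-comprehension⁻ P? {v} v∈ with P? v | trans (sym (lookup∘tabulate (does ∘ P?) v)) ([]=⇒lookup v∈)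
... | yes p | _ = p

-- Degree sum and spread in a graph.

module _ (G : Graph n) where
  open Graph G

  -- Every adjacency is split by which endpoint is smaller. The degree sum becomes two copies of the
  -- arc count, the second with its indices exchanged.
  handshake : sum (deg G) ≡ 2 * size G
  handshake = begin
    sum (deg G)
      ≡⟨ sum-cong-≗ (λ v → length-filter-tabulate (v ~?_) id) ⟩
    sum (λ v → sum (λ w → 𝟙 (v ~? w)))
      ≡⟨ sum-cong-≗ (λ v → sum-cong-≗ (oriented v)) ⟩
    sum (λ v → sum (λ w → 𝟙 (arc? (v , w)) + 𝟙 (arc? (w , v))))
      ≡⟨ sum-cong-≗ (λ v → ∑-distrib-+ (λ w → 𝟙 (arc? (v , w))) (λ w → 𝟙 (arc? (w , v)))) ⟩
    sum (λ v → sum (λ w → 𝟙 (arc? (v , w))) + sum (λ w → 𝟙 (arc? (w , v))))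
      ≡⟨ ∑-distrib-+ (λ v → sum (λ w → 𝟙 (arc? (v , w)))) (λ v → sum (λ w → 𝟙 (arc? (w , v)))) ⟩
    arcs + sum (λ v → sum (λ w → 𝟙 (arc? (w , v))))
      ≡⟨ cong (arcs +_) (∑-comm (λ v w → 𝟙 (arc? (w , v)))) ⟩
    arcs + arcs
      ≡⟨ cong₂ _+_ size≡ (trans (+-identityʳ _) size≡) ⟨
    2 * size G
      ∎
    where
    open ≡-Reasoning

    arc? : (e : Fin n × Fin n) → Dec (proj₁ e Fin.< proj₂ e × proj₁ e ~ proj₂ e)
    arc? e = (proj₁ e Fin.<? proj₂ e) ×-dec (proj₁ e ~? proj₂ e)

    arcs = sum (λ v → sum (λ w → 𝟙 (arc? (v , w))))

    size≡ : size G ≡ arcs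
    size≡ = length-filter-cartesianProduct arc? id id

    oriented : ∀ v w → 𝟙 (v ~? w) ≡ 𝟙 (arc? (v , w)) + 𝟙 (arc? (w , v))
    oriented v w with v ~? w
    -- The `with` has replaced `v ~? w` inside `arc? (v , w)` but leaves `arc? (w , v)` folded,
    -- hence the two different forms of decision.
    ... | no v≁w = sym (cong₂ _+_ (𝟙-no ((v Fin.<? w) ×-dec no v≁w) (v≁w ∘ proj₂))
                                  (𝟙-no (arc? (w , v)) (v≁w ∘ ~-sym ∘ proj₂)))
    ... | yes v~w with Fin.<-cmp v w
    ...   | tri< v<w _ w≮v = sym (cong₂ _+_ (𝟙-yes ((v Fin.<? w) ×-dec yes v~w) (v<w , v~w))
                                            (𝟙-no (arc? (w , v)) (w≮v ∘ proj₁)))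
    ...   | tri≈ _ v≡w _   = contradiction v~w (~-irrefl v≡w)
    ...   | tri> v≮w _ w<v = sym (cong₂ _+_ (𝟙-no ((v Fin.<? w) ×-dec yes v~w) (v≮w ∘ proj₁))
                                            (𝟙-yes (arc? (w , v)) (w<v , ~-sym v~w)))

  minDegree≤deg : ∀ v → minDegree G ≤ deg G v
  minDegree≤deg v = All.lookup (min≤xs _ (degreesIn G ⊤))
    (∈-map⁺ (deg G) (∈-filter⁺ (_∈? ⊤) (∈-allFin v) ∈⊤))

  spread≤ : ∀ {B} a {k} → (∀ {v} → v Subset.∈ B → a ≤ deg G v × deg G v ≤ a + k) → spread G B ≤ k
  spread≤ {B} a {k} bounds = m≤n+o⇒m∸n≤o (maxDegreeIn G B) _ (max≤min+k (argmin-sel id _ (degreesIn G B)))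
    where
    degree-bounds : ∀ {y} → y ∈ degreesIn G B → a ≤ y × y ≤ a + k
    degree-bounds y∈ with ∈-map⁻ (deg G) y∈
    ... | v , v∈ , refl = bounds (proj₂ (∈-filter⁻ (_∈? B) {xs = allFin n} v∈))

    max≤ : maxDegreeIn G B ≤ a + k
    max≤ = max≤v⁺ z≤n (All.tabulate (proj₂ ∘ degree-bounds))

    max≤min+k : _ → maxDegreeIn G B ≤ minDegreeIn G B + k
    -- Here the minimum is its default, the maximum itself, so the spread is 0; this covers the
    -- empty set.
    max≤min+k (inj₁ min≡max) = ≤-trans (≤-reflexive (sym min≡max)) (m≤m+n _ k)
    max≤min+k (inj₂ min∈)    = ≤-trans max≤ (+-monoˡ-≤ k (proj₁ (degree-bounds min∈)))

  ∣B∣≤sp : ∀ {k} B → spread G B ≤ k → ∣ B ∣ ≤ sp G k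
  ∣B∣≤sp {k} B spread≤k = All.lookup (xs≤max 0 _)
    (∈-map⁺ ∣_∣ (∈-filter⁺ (λ B → spread G B ≤? k) (∈-subsets B) spread≤k))

  numOfDegree≡ : ∀ j → numOfDegree G j ≡ sum (λ v → 𝟙 (deg G v ≟ j))
  numOfDegree≡ j = length-filter-tabulate (λ v → deg G v ≟ j) id

-- The intervals of length h, the weights and the gridpoints.

module _ (δ k : ℕ) where
  open Intervals δ k

  -- This is ε ≥ 0 with u replaced by its value `t ∸ i`. Truncated subtraction satisfies
  -- `t ≤ i + (t ∸ i)` for all `i`, so one computation covers intervals on either side of `t`.
  ∈I⇒δ+th≤ : ∀ {y} i → y ∈I i → ∀ t → δ + t * h ≤ h * (t ∸ i) + y
  ∈I⇒δ+th≤ {y} i (lo , _) t = begin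
    δ + t * h                   ≤⟨ +-monoʳ-≤ δ (*-monoˡ-≤ h (m≤n+m∸n t i)) ⟩
    δ + (i + (t ∸ i)) * h       ≡⟨ ring δ i (t ∸ i) h ⟩
    h * (t ∸ i) + (δ + i * h)   ≤⟨ +-monoʳ-≤ (h * (t ∸ i)) lo ⟩
    h * (t ∸ i) + y             ∎
    where
    open ≤-Reasoning
    ring : ∀ δ i j h → δ + (i + j) * h ≡ h * j + (δ + i * h)
    ring = solve-∀

  -- Division of y - δ by h: the quotient is the index, and the remainder is at most k = h - 1.
  interval-of : ∀ {y} → δ ≤ y → ∃[ i ] y ∈I i
  interval-of {y} δ≤y = q , lo , hi
    where
    open ≤-Reasoning
    q = (y ∸ δ) ℕ./ h
    r = (y ∸ δ) ℕ.% h
    y≡ : δ + q * h + r ≡ y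
    y≡ = begin-equality
      δ + q * h + r     ≡⟨ +-assoc δ _ _ ⟩
      δ + (q * h + r)   ≡⟨ cong (λ z → δ + z) (+-comm (q * h) r) ⟩
      δ + (r + q * h)   ≡⟨ cong (λ z → δ + z) (m≡m%n+[m/n]*n (y ∸ δ) h) ⟨
      δ + (y ∸ δ)       ≡⟨ m+[n∸m]≡n δ≤y ⟩
      y                 ∎
    lo : δ + q * h ≤ y
    lo = ≤-trans (m≤m+n _ r) (≤-reflexive y≡)
    hi : y ≤ δ + q * h + k
    hi = ≤-trans (≤-reflexive (sym y≡)) (+-monoʳ-≤ (δ + q * h) (≤-pred (m%n<n (y ∸ δ) h)))

  ∈I-≤ : ∀ {y} i j → y ∈I i → y ∈I j → i ≤ j
  ∈I-≤ {y} i j (lo , _) (_ , hi) = ≤-pred (*-cancelʳ-< h i (suc j) (+-cancelˡ-< δ _ _ (begin-strict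
    δ + i * h         ≤⟨ lo ⟩
    y                 ≤⟨ hi ⟩
    δ + j * h + k     <⟨ n<1+n _ ⟩
    -- As h = k + 1, one step past the right end of an interval is the left end of the next;
    -- cancelling δ and h leaves `i < suc j`.
    suc (δ + j * h + k) ≡⟨ ring δ (j * h) k ⟩
    δ + suc j * h     ∎)))
    where
    open ≤-Reasoning
    ring : ∀ a b k → suc (a + b + k) ≡ a + (suc k + b)
    ring = solve-∀

  ∈I-unique : ∀ {y} i j → y ∈I i → y ∈I j → i ≡ j
  ∈I-unique i j y∈i y∈j = ≤-antisym (∈I-≤ i j y∈i y∈j) (∈I-≤ j i y∈j y∈i)

  -- The intervals are disjoint, so only the index `i` can contribute to the sum. If `i ≥ t` it is
  -- out of range, and both sides are 0.
  u≡ : ∀ {y} t i → y ∈I i → u t y ≡ t ∸ i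
  u≡ {y} t i y∈ with i <? t
  ... | yes i<t = begin
      u t y             ≡⟨ sum-point (λ j → (t ∸ toℕ j) * μ y (toℕ j)) ι elsewhere ⟩
      (t ∸ toℕ ι) * μ y (toℕ ι) ≡⟨ cong (λ j → (t ∸ j) * μ y j) (Fin.toℕ-fromℕ< i<t) ⟩
      (t ∸ i) * μ y i   ≡⟨ cong (λ z → (t ∸ i) * z) (𝟙-yes (y ∈I? i) y∈) ⟩
      (t ∸ i) * 1       ≡⟨ *-identityʳ _ ⟩
      t ∸ i             ∎
    where
    open ≡-Reasoning
    ι = fromℕ< i<t
    elsewhere : ∀ j → j ≢ ι → (t ∸ toℕ j) * μ y (toℕ j) ≡ 0
    elsewhere j j≢ι = trans
      (cong (λ z → (t ∸ toℕ j) * z) (𝟙-no (y ∈I? toℕ j) λ y∈j →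
        j≢ι (Fin.toℕ-injective (trans (∈I-unique (toℕ j) i y∈j y∈) (sym (Fin.toℕ-fromℕ< i<t))))))
      (*-zeroʳ (t ∸ toℕ j))
  ... | no i≮t = trans (sum-zero _ vanishes) (sym (m≤n⇒m∸n≡0 (≮⇒≥ i≮t)))
    where
    vanishes : ∀ j → (t ∸ toℕ j) * μ y (toℕ j) ≡ 0
    vanishes j = trans
      (cong (λ z → (t ∸ toℕ j) * z) (𝟙-no (y ∈I? toℕ j) λ y∈j →
        i≮t (subst (_< t) (∈I-unique (toℕ j) i y∈j y∈) (Fin.toℕ<n j))))
      (*-zeroʳ (t ∸ toℕ j))

  δ+th≤hu+y : ∀ {y} t → δ ≤ y → δ + t * h ≤ h * u t y + y
  δ+th≤hu+y {y} t δ≤y with interval-of δ≤y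
  ... | i , y∈ = subst (λ z → δ + t * h ≤ h * z + y) (sym (u≡ t i y∈)) (∈I⇒δ+th≤ i y∈ t)

  -- The value of ε as a natural number: for `δ ≤ y` the subtraction is never truncated. Working
  -- with it keeps the summation arguments in ℕ.
  excess : ℕ → ℕ → ℕ
  excess t y = h * u t y + y ∸ (δ + t * h)

  hu+y≡ : ∀ {y} t → δ ≤ y → h * u t y + y ≡ δ + t * h + excess t y
  hu+y≡ t δ≤y = sym (m+[n∸m]≡n (δ+th≤hu+y t δ≤y))

  ε≡excess : ∀ {y} t → δ ≤ y → ε t y ≡ ℤ.+ excess t y
  ε≡excess {y} t δ≤y = begin
    ℤ.+ h ℤ.* ℤ.+ u t y ℤ.- (ℤ.+ (δ + t * h) ℤ.- ℤ.+ y)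
      ≡⟨ cong (ℤ._- (ℤ.+ (δ + t * h) ℤ.- ℤ.+ y)) (ℤ.pos-* h (u t y)) ⟨
    ℤ.+ (h * u t y) ℤ.- (ℤ.+ (δ + t * h) ℤ.- ℤ.+ y)
      ≡⟨ ring (ℤ.+ (h * u t y)) (ℤ.+ (δ + t * h)) (ℤ.+ y) ⟩
    ℤ.+ (h * u t y) ℤ.+ ℤ.+ y ℤ.- ℤ.+ (δ + t * h)
      ≡⟨ cong (λ z → ℤ.+ z ℤ.- ℤ.+ (δ + t * h)) (hu+y≡ t δ≤y) ⟩
    ℤ.+ (δ + t * h) ℤ.+ ℤ.+ excess t y ℤ.- ℤ.+ (δ + t * h)
      ≡⟨ ring′ (ℤ.+ (δ + t * h)) (ℤ.+ excess t y) ⟩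
    ℤ.+ excess t y
      ∎
    where
    open ≡-Reasoning
    ring : ∀ a b c → a ℤ.- (b ℤ.- c) ≡ a ℤ.+ c ℤ.- b
    ring = ℤ-Solver.solve-∀
    ring′ : ∀ a b → a ℤ.+ b ℤ.- a ≡ b
    ring′ = ℤ-Solver.solve-∀

  -- The zeros of ε among the numbers y ≥ δ; it unfolds to the degree condition of (ii).
  OnGrid : ℕ → ℕ → Set
  OnGrid t y = ∃[ i ] (i ≤ t × y ≡ δ + i * h)

  ∈I-gridpoint : ∀ i → (δ + i * h) ∈I i
  ∈I-gridpoint i = ≤-refl , m≤m+n _ k

  hu+y-gridpoint : ∀ {i t} → i ≤ t → h * (t ∸ i) + (δ + i * h) ≡ δ + t * h
  hu+y-gridpoint {i} {t} i≤t = begin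
    h * (t ∸ i) + (δ + i * h)  ≡⟨ ring δ i (t ∸ i) h ⟩
    δ + (t ∸ i + i) * h        ≡⟨ cong (λ z → δ + z * h) (m∸n+n≡m i≤t) ⟩
    δ + t * h                  ∎
    where
    open ≡-Reasoning
    ring : ∀ δ i j h → h * j + (δ + i * h) ≡ δ + (j + i) * h
    ring = solve-∀

  OnGrid⇒excess≡0 : ∀ {y} t → OnGrid t y → excess t y ≡ 0
  OnGrid⇒excess≡0 t (i , i≤t , refl) = m≤n⇒m∸n≡0 (≤-reflexive
    (trans (cong (λ z → h * z + (δ + i * h)) (u≡ t i (∈I-gridpoint i))) (hu+y-gridpoint i≤t)))

  -- If y lies in the interval of index `i ≤ t`, then u = t - i, and a zero excess pushes y down to
  -- the left end of that interval.
  excess≡0⇒OnGrid : ∀ {y} t → δ ≤ y → excess t y ≡ 0 → OnGrid t y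
  excess≡0⇒OnGrid {y} t δ≤y ex≡0 with interval-of δ≤y
  ... | i , y∈@(lo , _) with ≤-total i t
  ...   | inj₁ i≤t = i , i≤t , ≤-antisym
            (+-cancelˡ-≤ (h * (t ∸ i)) _ _
              (≤-trans tight (≤-reflexive (sym (hu+y-gridpoint i≤t))))) lo
    where
    tight : h * (t ∸ i) + y ≤ δ + t * h
    tight = subst (λ z → h * z + y ≤ δ + t * h) (u≡ t i y∈) (m∸n≡0⇒m≤n ex≡0)
  -- Discarding the term with u gives y ≤ δ + th, while y lies in an interval starting at or after δ
  -- + th; so y is the last gridpoint.
  ...   | inj₂ t≤i = t , ≤-refl , ≤-antisym
            (≤-trans (m≤n+m y _) (m∸n≡0⇒m≤n ex≡0))
            (≤-trans (+-monoʳ-≤ δ (*-monoˡ-≤ h t≤i)) lo)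

  -- The number of vertices with degree in a given interval.

  W≡ : (G : Graph n) → ∀ i → W G i ≡ sum (λ v → μ (deg G v) i)
  W≡ G i = begin
    W G i
      ≡⟨ sum-cong-≗ {suc k} (λ r → numOfDegree≡ G (δ + i * h + toℕ r)) ⟩
    sum {suc k} (λ r → sum (λ v → 𝟙 (deg G v ≟ δ + i * h + toℕ r)))
      ≡⟨ ∑-comm {suc k} (λ r v → 𝟙 (deg G v ≟ δ + i * h + toℕ r)) ⟩
    sum (λ v → sum {suc k} (λ r → 𝟙 (deg G v ≟ δ + i * h + toℕ r)))
      ≡⟨ sum-cong-≗ (λ v → offsets (deg G v)) ⟩
    sum (λ v → μ (deg G v) i)
      ∎
    where
    open ≡-Reasoning
    a = δ + i * h
    -- Only the offset r = y - a can match, and it is a valid index exactly when a ≤ y ≤ a + k.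
    offsets : ∀ y → sum {suc k} (λ r → 𝟙 (y ≟ a + toℕ r)) ≡ μ y i
    offsets y = case y ∈I? i of λ where
        (no y∉) → trans
          (sum-zero {suc k} _ λ r → 𝟙-no (y ≟ a + toℕ r) λ y≡ → y∉
            ( ≤-trans (m≤m+n a _) (≤-reflexive (sym y≡))
            , ≤-trans (≤-reflexive y≡) (+-monoʳ-≤ a (Fin.toℕ≤pred[n] r))))
          (sym (𝟙-no (y ∈I? i) y∉))
        (yes y∈@(lo , hi)) →
          let r<h = s≤s (m≤n+o⇒m∸n≤o y a hi)
              y≡  = trans (sym (m+[n∸m]≡n lo)) (cong (λ z → a + z) (sym (Fin.toℕ-fromℕ< r<h)))
          in trans
          (sum-point (λ r → 𝟙 (y ≟ a + toℕ r)) (fromℕ< r<h) λ r r≢ →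
            𝟙-no (y ≟ a + toℕ r) λ y≡′ →
              r≢ (Fin.toℕ-injective (+-cancelˡ-≡ a _ _ (trans (sym y≡′) y≡))))
          (trans (𝟙-yes (y ≟ _) y≡) (sym (𝟙-yes (y ∈I? i) y∈)))

  W≤sp : (G : Graph n) → ∀ i → W G i ≤ sp G k
  W≤sp G i = ≤-trans (≤-reflexive (trans (W≡ G i) (sym (∣comprehension∣ (λ v → deg G v ∈I? i)))))
    (∣B∣≤sp G _ (spread≤ G (δ + i * h) (∈-comprehension⁻ (λ v → deg G v ∈I? i))))

  -- Each interval contains just one gridpoint, its left end, so the only degree it can capture is
  -- that one.
  OnGrid⇒W≡numOfDegree : (G : Graph n) → ∀ {t} → (∀ v → OnGrid t (deg G v)) → ∀ i → W G i ≡ numOfDegree G (δ + i * h)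
  OnGrid⇒W≡numOfDegree G grid i = trans (W≡ G i) (trans (sum-cong-≗ atGridpoint) (sym (numOfDegree≡ G (δ + i * h))))
    where
    atGridpoint : ∀ v → μ (deg G v) i ≡ 𝟙 (deg G v ≟ δ + i * h)
    atGridpoint v with grid v
    ... | j , _ , y≡ = 𝟙-cong (deg G v ∈I? i) (deg G v ≟ δ + i * h)
      (λ y∈ → trans y≡ (cong (λ z → δ + z * h)
        (∈I-unique j i (subst (_∈I j) (sym y≡) (∈I-gridpoint j)) y∈)))
      (λ y≡′ → subst (_∈I i) (sym y≡′) (∈I-gridpoint i))

-- Sums over all vertices, and when the estimates are sharp.

module Totals (G : Graph n) (k t : ℕ) where
  private
    m = size G
    δ = minDegree G
    s = sp G k
  open Intervals δ k

  totalU totalExcess : ℕ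
  totalU = sum (λ v → u t (deg G v))
  totalExcess = sum (λ v → excess δ k t (deg G v))

  -- The definition of ε summed over all degrees, with the subtractions moved across so that the
  -- identity lives in ℕ; the handshake lemma supplies 2m.
  hU+2m≡n[δ+th]+E : h * totalU + 2 * m ≡ n * (δ + t * h) + totalExcess
  hU+2m≡n[δ+th]+E = begin
    h * totalU + 2 * m
      ≡⟨ cong₂ _+_ (*-distribˡ-sum h (λ v → u t (deg G v))) (sym (handshake G)) ⟩
    sum (λ v → h * u t (deg G v)) + sum (deg G)
      ≡⟨ ∑-distrib-+ (λ v → h * u t (deg G v)) (deg G) ⟨
    sum (λ v → h * u t (deg G v) + deg G v)
      ≡⟨ sum-cong-≗ (λ v → hu+y≡ δ k t (minDegree≤deg G v)) ⟩
    sum (λ v → δ + t * h + excess δ k t (deg G v))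
      ≡⟨ ∑-distrib-+ (λ _ → δ + t * h) (λ v → excess δ k t (deg G v)) ⟩
    sum {n} (λ _ → δ + t * h) + totalExcess
      ≡⟨ cong (_+ totalExcess) (sum-const n (δ + t * h)) ⟩
    n * (δ + t * h) + totalExcess
      ∎
    where open ≡-Reasoning

  totalU≡ : totalU ≡ sum {t} (λ i → (t ∸ toℕ i) * W G (toℕ i))
  totalU≡ = begin
    totalU
      ≡⟨ ∑-comm (λ v (i : Fin t) → (t ∸ toℕ i) * μ (deg G v) (toℕ i)) ⟩
    sum {t} (λ i → sum (λ v → (t ∸ toℕ i) * μ (deg G v) (toℕ i)))
      ≡⟨ sum-cong-≗ {t} (λ i → *-distribˡ-sum (t ∸ toℕ i) (λ v → μ (deg G v) (toℕ i))) ⟨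
    sum {t} (λ i → (t ∸ toℕ i) * sum (λ v → μ (deg G v) (toℕ i)))
      ≡⟨ sum-cong-≗ {t} (λ i → cong ((t ∸ toℕ i) *_) (W≡ δ k G (toℕ i))) ⟨
    sum {t} (λ i → (t ∸ toℕ i) * W G (toℕ i))
      ∎
    where open ≡-Reasoning

  -- The extremal value of `2 * (h * totalU)`, reached when every count `W G i` with `i < t` equals
  -- s.
  s*D : s * denominator t ≡ 2 * (h * sum {t} (λ i → (t ∸ toℕ i) * s))
  s*D = begin
    s * (h * (t * suc t))                         ≡⟨ cong (λ z → s * (h * z)) (triangular t) ⟨
    s * (h * (2 * sum {t} (λ i → t ∸ toℕ i)))     ≡⟨ ring s h (sum {t} (λ i → t ∸ toℕ i)) ⟩
    2 * (h * (sum {t} (λ i → t ∸ toℕ i) * s))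
      ≡⟨ cong (λ z → 2 * (h * z)) (*-distribʳ-sum {t} s (λ i → t ∸ toℕ i)) ⟩
    2 * (h * sum {t} (λ i → (t ∸ toℕ i) * s))     ∎
    where
    open ≡-Reasoning
    ring : ∀ s h a → s * (h * (2 * a)) ≡ 2 * (h * (a * s))
    ring = solve-∀

  summand≤ : ∀ i → (t ∸ toℕ {t} i) * W G (toℕ i) ≤ (t ∸ toℕ i) * s
  summand≤ i = *-monoʳ-≤ (t ∸ toℕ i) (W≤sp δ k G (toℕ i))

  2hU≤s*D : 2 * (h * totalU) ≤ s * denominator t
  2hU≤s*D = begin
    2 * (h * totalU)                                    ≡⟨ cong (λ z → 2 * (h * z)) totalU≡ ⟩
    2 * (h * sum {t} (λ i → (t ∸ toℕ i) * W G (toℕ i))) ≤⟨ *-monoʳ-≤ 2 (*-monoʳ-≤ h (sum-mono-≤ summand≤)) ⟩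
    2 * (h * sum {t} (λ i → (t ∸ toℕ i) * s))           ≡⟨ s*D ⟨
    s * denominator t                                   ∎
    where open ≤-Reasoning

  -- Equality of the weighted sums forces equality of each summand, and the weight `t ∸ i` is
  -- positive for `i < t`, so it cancels.
  s*D≡2hU⇔W≡s : s * denominator t ≡ 2 * (h * totalU) ⇔ (∀ i → i < t → W G i ≡ s)
  s*D≡2hU⇔W≡s = mk⇔ to from
    where
    to : s * denominator t ≡ 2 * (h * totalU) → ∀ i → i < t → W G i ≡ s
    to eq i i<t = *-cancelˡ-≡ _ _ (t ∸ i) {{>-nonZero (m<n⇒0<n∸m i<t)}}
      (subst (λ j → (t ∸ j) * W G j ≡ (t ∸ j) * s) (Fin.toℕ-fromℕ< i<t)
        (sum-injective-≤ summand≤ sums≡ (fromℕ< i<t)))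
      where
      sums≡ : sum {t} (λ i → (t ∸ toℕ i) * W G (toℕ i)) ≡ sum {t} (λ i → (t ∸ toℕ i) * s)
      sums≡ = trans (sym totalU≡)
        (*-cancelˡ-≡ _ _ h (*-cancelˡ-≡ _ _ 2 (trans (sym eq) s*D)))
    from : (∀ i → i < t → W G i ≡ s) → s * denominator t ≡ 2 * (h * totalU)
    from W≡s = trans s*D (cong (λ z → 2 * (h * z)) (trans
      (sum-cong-≗ {t} (λ i → cong ((t ∸ toℕ i) *_) (sym (W≡s (toℕ i) (Fin.toℕ<n i)))))
      (sym totalU≡)))

  -- The summed identity turns the left equation into 2hU = sD + 2E, where D is the denominator, U
  -- is `totalU` and E is `totalExcess`. Since also 2hU ≤ sD, this forces E = 0.
  tight⇔ : s * denominator t + 2 * (2 * m) ≡ 2 * (n * (δ + t * h)) ⇔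
           (totalExcess ≡ 0 × s * denominator t ≡ 2 * (h * totalU))
  tight⇔ = mk⇔ to from
    where
    open ≡-Reasoning
    D = denominator t
    N = n * (δ + t * h)
    doubled : 2 * (h * totalU) + 2 * (2 * m) ≡ 2 * N + 2 * totalExcess
    doubled = begin
      2 * (h * totalU) + 2 * (2 * m) ≡⟨ *-distribˡ-+ 2 (h * totalU) (2 * m) ⟨
      2 * (h * totalU + 2 * m)       ≡⟨ cong (2 *_) hU+2m≡n[δ+th]+E ⟩
      2 * (N + totalExcess)          ≡⟨ *-distribˡ-+ 2 N totalExcess ⟩
      2 * N + 2 * totalExcess        ∎
    to : s * D + 2 * (2 * m) ≡ 2 * N → totalExcess ≡ 0 × s * D ≡ 2 * (h * totalU)
    to eq = E≡0 , sym (trans hU≡ (trans (cong (λ e → s * D + 2 * e) E≡0) (+-identityʳ _)))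
      where
      hU≡ : 2 * (h * totalU) ≡ s * D + 2 * totalExcess
      hU≡ = +-cancelʳ-≡ (2 * (2 * m)) _ _ (begin
        2 * (h * totalU) + 2 * (2 * m)            ≡⟨ doubled ⟩
        2 * N + 2 * totalExcess                   ≡⟨ cong (_+ 2 * totalExcess) eq ⟨
        s * D + 2 * (2 * m) + 2 * totalExcess     ≡⟨ swap (s * D) (2 * (2 * m)) (2 * totalExcess) ⟩
        s * D + 2 * totalExcess + 2 * (2 * m)     ∎)
        where
        swap : ∀ a b c → a + b + c ≡ a + c + b
        swap = solve-∀
      E≡0 : totalExcess ≡ 0
      E≡0 = *-cancelˡ-≡ _ 0 2 (n≤0⇒n≡0 (+-cancelˡ-≤ (s * D) _ 0
        (≤-trans (≤-reflexive (sym hU≡)) (≤-trans 2hU≤s*D (≤-reflexive (sym (+-identityʳ _)))))))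
    from : totalExcess ≡ 0 × s * D ≡ 2 * (h * totalU) → s * D + 2 * (2 * m) ≡ 2 * N
    from (E≡0 , eq) = begin
      s * D + 2 * (2 * m)               ≡⟨ cong (_+ 2 * (2 * m)) eq ⟩
      2 * (h * totalU) + 2 * (2 * m)    ≡⟨ doubled ⟩
      2 * N + 2 * totalExcess           ≡⟨ cong (λ e → 2 * N + 2 * e) E≡0 ⟩
      2 * N + 0                         ≡⟨ +-identityʳ _ ⟩
      2 * N                             ∎

  totalExcess≡0⇔ : totalExcess ≡ 0 ⇔ (∀ v → OnGrid δ k t (deg G v))
  totalExcess≡0⇔ = mk⇔
    (λ E≡0 v → excess≡0⇒OnGrid δ k t (minDegree≤deg G v)
      -- The zero function is the termwise lower bound, and its sum equals that of the excesses.
      (sym (sum-injective-≤ (λ _ → z≤n) (trans (sum-zero {n} (λ _ → 0) (λ _ → refl)) (sym E≡0)) v)))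
    (λ grid → sum-zero _ (λ v → OnGrid⇒excess≡0 δ k t (grid v)))

  -- Each degree is a gridpoint of index at most t, so it lies in exactly one of the t + 1
  -- intervals; counting vertices by interval exhausts n.
  n≡ΣW : (∀ v → OnGrid δ k t (deg G v)) → n ≡ sum {suc t} (λ i → W G (toℕ i))
  n≡ΣW grid = begin
    n
      ≡⟨ trans (sum-const n 1) (*-identityʳ n) ⟨
    sum {n} (λ _ → 1)
      ≡⟨ sum-cong-≗ (λ v → sym (oneInterval v)) ⟩
    sum (λ v → sum {suc t} (λ i → μ (deg G v) (toℕ i)))
      ≡⟨ ∑-comm (λ v (i : Fin (suc t)) → μ (deg G v) (toℕ i)) ⟩
    sum {suc t} (λ i → sum (λ v → μ (deg G v) (toℕ i)))
      ≡⟨ sum-cong-≗ {suc t} (λ i → W≡ δ k G (toℕ i)) ⟨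
    sum {suc t} (λ i → W G (toℕ i))
      ∎
    where
    open ≡-Reasoning
    oneInterval : ∀ v → sum {suc t} (λ i → μ (deg G v) (toℕ i)) ≡ 1
    oneInterval v with grid v
    ... | j , j≤t , y≡ = trans
        (sum-point {suc t} (λ i → μ (deg G v) (toℕ i)) (fromℕ< (s≤s j≤t)) λ i i≢ →
          𝟙-no (deg G v ∈I? toℕ i) λ y∈ → i≢ (Fin.toℕ-injective
            (trans (∈I-unique δ k (toℕ i) j y∈ y∈j) (sym (Fin.toℕ-fromℕ< (s≤s j≤t))))))
        (𝟙-yes (deg G v ∈I? toℕ (fromℕ< (s≤s j≤t))) (subst (deg G v ∈I_) (sym (Fin.toℕ-fromℕ< (s≤s j≤t))) y∈j))
      where
      y∈j : deg G v ∈I j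
      y∈j = subst (_∈I j) (sym y≡) (∈I-gridpoint δ k j)

  n≡ts+W : (∀ v → OnGrid δ k t (deg G v)) → (∀ i → i < t → W G i ≡ s) → n ≡ t * s + W G t
  n≡ts+W grid W≡s = begin
    n                                                   ≡⟨ n≡ΣW grid ⟩
    sum {suc t} (λ i → W G (toℕ i))                     ≡⟨ sum-init-last {t} (λ i → W G (toℕ i)) ⟩
    sum {t} (λ i → W G (toℕ (Fin.inject₁ i))) + W G (toℕ (Fin.fromℕ t))
      ≡⟨ cong₂ _+_
           (trans (sum-cong-≗ {t} (λ i → trans (cong (W G) (Fin.toℕ-inject₁ i)) (W≡s (toℕ i) (Fin.toℕ<n i))))
                  (sum-const t s))
           (cong (W G) (Fin.toℕ-fromℕ t)) ⟩
    t * s + W G t                                       ∎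
    where open ≡-Reasoning

-- From rational and integer statements to equations in ℕ.

open import Data.Integer.Base using (+_)
open import Data.Rational.Base using (_/_; 1ℚ)
open Equivalence using (to; from)

toℚᵘ-/ : ∀ p q .{{_ : NonZero q}} → ℚ.toℚᵘ (p / q) ℚᵘ.≃ p ℚᵘ./ q
toℚᵘ-/ p (suc q) = ℚ.toℚᵘ-fromℚᵘ (mkℚᵘ p q)

-- Matching `q` as a successor exposes both fractions as values of `fromℚᵘ`, whose injectivity up to
-- `≃` reduces equality to cross multiplication.
/1≡/⇔ : ∀ a p q .{{_ : NonZero q}} → a / 1 ≡ p / q ⇔ a ℤ.* + q ≡ p
/1≡/⇔ a p q@(suc _) = mk⇔
  (λ eq → trans (ℚᵘ.drop-*≡* (ℚ.fromℚᵘ-injective {mkℚᵘ a 0} {mkℚᵘ p _} eq)) (ℤ.*-identityʳ p))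
  (λ eq → ℚ.fromℚᵘ-cong {mkℚᵘ a 0} {mkℚᵘ p _} (*≡* (trans eq (sym (ℤ.*-identityʳ p)))))

/≤/ : ∀ {a b} p q .{{_ : NonZero p}} .{{_ : NonZero q}} → a * q ≤ b * p → + a / p ℚ.≤ + b / q
/≤/ {a} {b} p@(suc _) q@(suc _) a*q≤b*p = ℚ.toℚᵘ-cancel-≤
  (ℚᵘ.≤-respˡ-≃ (ℚᵘ.≃-sym (toℚᵘ-/ (+ a) p)) (ℚᵘ.≤-respʳ-≃ (ℚᵘ.≃-sym (toℚᵘ-/ (+ b) q))
    (*≤* (subst₂ ℤ._≤_ (ℤ.pos-* a q) (ℤ.pos-* b p) (ℤ.+≤+ a*q≤b*p)))))

-- Clears the subtraction in the numerator of f, with b = n(δ + th) and c = 2m.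
≡2[-]⇔ : ∀ a b c → + a ≡ + 2 ℤ.* (+ b ℤ.- + c) ⇔ a + 2 * c ≡ 2 * b
≡2[-]⇔ a b c = mk⇔
  (λ eq → ℤ.+-injective (begin
    + a ℤ.+ + (2 * c)                              ≡⟨ cong₂ ℤ._+_ eq (ℤ.pos-* 2 c) ⟩
    + 2 ℤ.* (+ b ℤ.- + c) ℤ.+ + 2 ℤ.* + c          ≡⟨ ring (+ b) (+ c) ⟩
    + 2 ℤ.* + b                                    ≡⟨ ℤ.pos-* 2 b ⟨
    + (2 * b)                                      ∎))
  (λ eq → begin
    + a                                            ≡⟨ ring′ (+ a) (+ c) ⟩
    + a ℤ.+ + 2 ℤ.* + c ℤ.- + 2 ℤ.* + c            ≡⟨ cong (λ z → + a ℤ.+ z ℤ.- + 2 ℤ.* + c) (ℤ.pos-* 2 c) ⟨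
    + (a + 2 * c) ℤ.- + 2 ℤ.* + c                  ≡⟨ cong (λ z → + z ℤ.- + 2 ℤ.* + c) eq ⟩
    + (2 * b) ℤ.- + 2 ℤ.* + c                      ≡⟨ cong (ℤ._- + 2 ℤ.* + c) (ℤ.pos-* 2 b) ⟩
    + 2 ℤ.* + b ℤ.- + 2 ℤ.* + c                    ≡⟨ ring″ (+ b) (+ c) ⟩
    + 2 ℤ.* (+ b ℤ.- + c)                          ∎)
  where
  open ≡-Reasoning
  ring : ∀ b c → + 2 ℤ.* (b ℤ.- c) ℤ.+ + 2 ℤ.* c ≡ + 2 ℤ.* b
  ring = ℤ-Solver.solve-∀
  ring′ : ∀ a c → a ≡ a ℤ.+ + 2 ℤ.* c ℤ.- + 2 ℤ.* c
  ring′ = ℤ-Solver.solve-∀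
  ring″ : ∀ b c → + 2 ℤ.* b ℤ.- + 2 ℤ.* c ≡ + 2 ℤ.* (b ℤ.- c)
  ring″ = ℤ-Solver.solve-∀

pos-complement : ∀ {a c} b → a ≡ b + c → + c ≡ + a ℤ.- + b
pos-complement {c = c} b refl = ring (+ b) (+ c)
  where
  ring : ∀ b c → c ≡ b ℤ.+ c ℤ.- b
  ring = ℤ-Solver.solve-∀

-- The left-hand side is the denominator that ℚᵘ arithmetic produces for 2xᵘ below.
2xᵘ-denominator : ∀ n h → + (1 * (n * 1 * h)) ≡ + n ℤ.* + h
2xᵘ-denominator n h = trans (cong (λ a → + a) (ring n h)) (ℤ.pos-* n h)
  where
  ring : ∀ n h → 1 * (n * 1 * h) ≡ n * h
  ring = solve-∀

≡-cong-⇔ : ∀ {a b a′ b′ : ℤ} → a ≡ a′ → b ≡ b′ → a ≡ b ⇔ a′ ≡ b′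
≡-cong-⇔ refl refl = mk⇔ id id

-- The equality cases of both bounds and their consequences.

module Equalities (G : Graph n) (k t : ℕ) .{{_ : NonZero t}} where
  private
    m = size G
    δ = minDegree G
    s = sp G k
  open Intervals δ k
  open Totals G k t
  private instance
    D≢0 : NonZero (denominator t)
    D≢0 = denominator≢0 t

  -- The ε terms add up to `totalExcess`; by the summed identity 2m then cancels and the numerator
  -- is 2hU.
  refinedBound⇔ : + s / 1 ≡ refinedBound G t ⇔ s * denominator t ≡ 2 * (h * totalU)
  refinedBound⇔ =
    mk⇔ ℤ.+-injective (cong (λ a → + a))
    ⇔-∘ (≡-cong-⇔ (sym (ℤ.pos-* s _)) numerator≡
    ⇔-∘ /1≡/⇔ (+ s) _ (denominator t))
    where
    open ≡-Reasoning
    N = n * (δ + t * h)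
    ring : ∀ a b c → a ℤ.- b ℤ.+ c ≡ a ℤ.+ c ℤ.- b
    ring = ℤ-Solver.solve-∀
    ring′ : ∀ a b → + 2 ℤ.* (a ℤ.+ b ℤ.- b) ≡ + 2 ℤ.* a
    ring′ = ℤ-Solver.solve-∀
    numerator≡ : + 2 ℤ.* (+ n ℤ.* + (δ + t * h) ℤ.- + (2 * m) ℤ.+ ℤ-Sum.sum (λ v → ε t (deg G v)))
                 ≡ + (2 * (h * totalU))
    numerator≡ = begin
      + 2 ℤ.* (+ n ℤ.* + (δ + t * h) ℤ.- + (2 * m) ℤ.+ ℤ-Sum.sum (λ v → ε t (deg G v)))
        ≡⟨ cong₂ (λ a b → + 2 ℤ.* (a ℤ.- + (2 * m) ℤ.+ b))
             (sym (ℤ.pos-* n (δ + t * h)))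
             (trans (ℤ-Sum.sum-cong-≗ (λ v → ε≡excess δ k t (minDegree≤deg G v)))
                    (sum-pos (λ v → excess δ k t (deg G v)))) ⟩
      + 2 ℤ.* (+ N ℤ.- + (2 * m) ℤ.+ + totalExcess)
        ≡⟨ cong (+ 2 ℤ.*_) (ring (+ N) (+ (2 * m)) (+ totalExcess)) ⟩
      + 2 ℤ.* (+ (N + totalExcess) ℤ.- + (2 * m))
        ≡⟨ cong (λ z → + 2 ℤ.* (+ z ℤ.- + (2 * m))) hU+2m≡n[δ+th]+E ⟨
      + 2 ℤ.* (+ (h * totalU) ℤ.+ + (2 * m) ℤ.- + (2 * m))
        ≡⟨ ring′ (+ (h * totalU)) (+ (2 * m)) ⟩
      + 2 ℤ.* + (h * totalU)
        ≡⟨ ℤ.pos-* 2 (h * totalU) ⟨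
      + (2 * (h * totalU))
        ∎

  -- s = f_t with denominators and subtraction cleared.
  Tight : Set
  Tight = s * denominator t + 2 * (2 * m) ≡ 2 * (n * (δ + t * h))

  s≡f⇔ : + s / 1 ≡ f n m t ⇔ Tight
  s≡f⇔ =
    ≡2[-]⇔ _ (n * (δ + t * h)) (2 * m)
    ⇔-∘ (≡-cong-⇔ (sym (ℤ.pos-* s _))
               (cong (λ z → + 2 ℤ.* (z ℤ.- + (2 * m))) (sym (ℤ.pos-* n (δ + t * h))))
    ⇔-∘ /1≡/⇔ (+ s) _ (denominator t))

  s≡refinedBound⇔ : + s / 1 ≡ refinedBound G t ⇔ (∀ i → i < t → W G i ≡ s)
  s≡refinedBound⇔ = s*D≡2hU⇔W≡s ⇔-∘ refinedBound⇔

  tight⇒grid : Tight → ∀ v → OnGrid δ k t (deg G v)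
  tight⇒grid eq = to totalExcess≡0⇔ (proj₁ (to tight⇔ eq))

  tight⇒W≡s : Tight → ∀ i → i < t → W G i ≡ s
  tight⇒W≡s eq = to s*D≡2hU⇔W≡s (proj₂ (to tight⇔ eq))

  tight⇒n≡ts+W : Tight → n ≡ t * s + W G t
  tight⇒n≡ts+W eq = n≡ts+W (tight⇒grid eq) (tight⇒W≡s eq)

  tight⇒n_δ+ih≡s : Tight → ∀ i → i < t → numOfDegree G (δ + i * h) ≡ s
  tight⇒n_δ+ih≡s eq i i<t = trans (sym (OnGrid⇒W≡numOfDegree δ k G (tight⇒grid eq) i)) (tight⇒W≡s eq i i<t)

  tight⇒W≡n-ts : Tight → + W G t ≡ + n ℤ.- + (t * s)
  tight⇒W≡n-ts eq = pos-complement (t * s) (tight⇒n≡ts+W eq)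

  tight⇒n_δ+th≡n-ts : Tight → + numOfDegree G (δ + t * h) ≡ + n ℤ.- + (t * s)
  tight⇒n_δ+th≡n-ts eq =
    trans (cong (λ a → + a) (sym (OnGrid⇒W≡numOfDegree δ k G (tight⇒grid eq) t))) (tight⇒W≡n-ts eq)

  tight⇒n-ts≤s : Tight → + n ℤ.- + (t * s) ℤ.≤ + s
  tight⇒n-ts≤s eq = ℤ.≤-trans (ℤ.≤-reflexive (sym (tight⇒W≡n-ts eq))) (ℤ.+≤+ (W≤sp δ k G t))

  -- The difference n - ts is taken in ℤ, so the third component asserts an exact count rather than
  -- a truncated one.
  Profile : Set
  Profile =
      (∀ v → ∃[ i ] (i ≤ t × deg G v ≡ δ + i * h))
    × (∀ i → i < t → numOfDegree G (δ + i * h) ≡ s)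
    × + numOfDegree G (δ + t * h) ≡ + n ℤ.- + (t * s)
    × + n ℤ.- + (t * s) ℤ.≤ + s

  tight⇒profile : Tight → Profile
  tight⇒profile eq = tight⇒grid eq , tight⇒n_δ+ih≡s eq , tight⇒n_δ+th≡n-ts eq , tight⇒n-ts≤s eq

  profile⇒tight : Profile → Tight
  profile⇒tight (grid , num≡s , _) = from tight⇔
    ( from totalExcess≡0⇔ grid
    , from s*D≡2hU⇔W≡s (λ i i<t → trans (OnGrid⇒W≡numOfDegree δ k G grid i) (num≡s i i<t)))

  ts≤n : Tight → t * s ≤ n
  ts≤n eq = ≤-trans (m≤m+n _ _) (≤-reflexive (sym (tight⇒n≡ts+W eq)))

  n≤[1+t]s : Tight → n ≤ suc t * s
  n≤[1+t]s eq = begin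
    n               ≡⟨ tight⇒n≡ts+W eq ⟩
    t * s + W G t   ≤⟨ +-monoʳ-≤ (t * s) (W≤sp δ k G t) ⟩
    t * s + s       ≡⟨ +-comm (t * s) s ⟩
    suc t * s       ∎
    where open ≤-Reasoning

  -- This is t - 1 ≤ 2x multiplied by nh and freed of subtraction. It comes from putting ts ≤ n into
  -- the tight equation.
  tight⇒nht+2nδ≤nh+4m : Tight → n * h * t + 2 * (n * δ) ≤ n * h + 2 * (2 * m)
  -- Adding nht to both sides produces 2n(δ + th), the right-hand side of `Tight`.
  tight⇒nht+2nδ≤nh+4m eq = +-cancelˡ-≤ (n * h * t) _ _ (begin
    n * h * t + (n * h * t + 2 * (n * δ))    ≡⟨ ring n h t δ ⟩
    2 * (n * (δ + t * h))                    ≡⟨ eq ⟨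
    s * (h * (t * suc t)) + 2 * (2 * m)      ≡⟨ ring′ s h t (2 * (2 * m)) ⟩
    t * s * (h * suc t) + 2 * (2 * m)        ≤⟨ +-monoˡ-≤ _ (*-monoˡ-≤ (h * suc t) (ts≤n eq)) ⟩
    n * (h * suc t) + 2 * (2 * m)            ≡⟨ ring″ n h t (2 * (2 * m)) ⟩
    n * h * t + (n * h + 2 * (2 * m))        ∎)
    where
    open ≤-Reasoning
    ring : ∀ n h t δ → n * h * t + (n * h * t + 2 * (n * δ)) ≡ 2 * (n * (δ + t * h))
    ring = solve-∀
    ring′ : ∀ s h t a → s * (h * (t * suc t)) + a ≡ t * s * (h * suc t) + a
    ring′ = solve-∀
    ring″ : ∀ n h t a → n * (h * suc t) + a ≡ n * h * t + (n * h + a)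
    ring″ = solve-∀

  -- This is 2x ≤ t multiplied by nh, and comes from n ≤ (t + 1)s in the same way.
  tight⇒4m≤nht+2nδ : Tight → 2 * (2 * m) ≤ n * h * t + 2 * (n * δ)
  tight⇒4m≤nht+2nδ eq = +-cancelˡ-≤ (n * h * t) _ _ (begin
    n * h * t + 2 * (2 * m)                  ≡⟨ ring″ n h t (2 * (2 * m)) ⟩
    n * (h * t) + 2 * (2 * m)                ≤⟨ +-monoˡ-≤ _ (*-monoˡ-≤ (h * t) (n≤[1+t]s eq)) ⟩
    suc t * s * (h * t) + 2 * (2 * m)        ≡⟨ ring′ s h t (2 * (2 * m)) ⟩
    s * (h * (t * suc t)) + 2 * (2 * m)      ≡⟨ eq ⟩
    2 * (n * (δ + t * h))                    ≡⟨ ring n h t δ ⟩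
    n * h * t + (n * h * t + 2 * (n * δ))    ∎)
    where
    open ≤-Reasoning
    ring : ∀ n h t δ → 2 * (n * (δ + t * h)) ≡ n * h * t + (n * h * t + 2 * (n * δ))
    ring = solve-∀
    ring′ : ∀ s h t a → suc t * s * (h * t) + a ≡ s * (h * (t * suc t)) + a
    ring′ = solve-∀
    ring″ : ∀ n h t a → n * h * t + a ≡ n * (h * t) + a
    ring″ = solve-∀

-- The bounds on 2x as rational inequalities.

module _ (δ k m t : ℕ) where
  open Intervals δ k

  -- An unnormalised copy of 2x: its numerator and denominator compute, so comparisons become
  -- polynomial inequalities over ℤ.
  2xᵘ : ∀ n .{{_ : NonZero n}} → ℚᵘ
  2xᵘ n = + 2 ℚᵘ./ 1 ℚᵘ.* ((+ (2 * m) ℚᵘ./ n ℚᵘ.- + δ ℚᵘ./ 1) ℚᵘ.* (+ 1 ℚᵘ./ h))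

  toℚᵘ-2x : ∀ n .{{_ : NonZero n}} → ℚ.toℚᵘ (+ 2 / 1 ℚ.* x n m) ℚᵘ.≃ 2xᵘ n
  toℚᵘ-2x n = begin
    ℚ.toℚᵘ (+ 2 / 1 ℚ.* x n m)
      ≈⟨ ℚ.toℚᵘ-homo-* (+ 2 / 1) (x n m) ⟩
    ℚ.toℚᵘ (+ 2 / 1) ℚᵘ.* ℚ.toℚᵘ (x n m)
      ≈⟨ ℚᵘ.*-cong (toℚᵘ-/ (+ 2) 1) (ℚ.toℚᵘ-homo-* (d n m ℚ.- + δ / 1) (+ 1 / h)) ⟩
    + 2 ℚᵘ./ 1 ℚᵘ.* (ℚ.toℚᵘ (d n m ℚ.- + δ / 1) ℚᵘ.* ℚ.toℚᵘ (+ 1 / h))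
      ≈⟨ ℚᵘ.*-congˡ {+ 2 ℚᵘ./ 1} (ℚᵘ.*-cong
           (ℚᵘ.≃-trans (ℚ.toℚᵘ-homo-+ (d n m) (ℚ.- (+ δ / 1)))
             (ℚᵘ.+-cong (toℚᵘ-/ (+ (2 * m)) n)
               (ℚᵘ.≃-trans (ℚ.toℚᵘ-homo‿- (+ δ / 1)) (ℚᵘ.-‿cong (toℚᵘ-/ (+ δ) 1)))))
           (toℚᵘ-/ (+ 1) h)) ⟩
    2xᵘ n
      ∎
    where open import Relation.Binary.Reasoning.Setoid ℚᵘ.≃-setoid

  t-1≤2x : ∀ n .{{_ : NonZero n}} → n * h * t + 2 * (n * δ) ≤ n * h + 2 * (2 * m) →
           + t / 1 ℚ.- 1ℚ ℚ.≤ + 2 / 1 ℚ.* x n m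
  t-1≤2x n@(suc _) le = ℚ.toℚᵘ-cancel-≤
    (ℚᵘ.≤-respˡ-≃ (ℚᵘ.≃-sym toℚᵘ-t-1) (ℚᵘ.≤-respʳ-≃ (ℚᵘ.≃-sym (toℚᵘ-2x n))
      (*≤* (subst₂ ℤ._≤_ (sym lhs) (sym rhs)
        -- Subtracting nh + 2nδ from both sides of `le′` yields nh(t - 1) ≤ 2(2m - nδ), the
        -- cross-multiplied goal.
        (ℤ.+-monoˡ-≤ (ℤ.- (N ℤ.* H ℤ.+ + 2 ℤ.* (N ℤ.* Δ))) le′)))))
    where
    T = + t ; N = + n ; H = + h ; M = + (2 * m) ; Δ = + δ
    le′ : N ℤ.* H ℤ.* T ℤ.+ + 2 ℤ.* (N ℤ.* Δ) ℤ.≤ N ℤ.* H ℤ.+ + 2 ℤ.* M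
    le′ = subst₂ ℤ._≤_
      (cong₂ ℤ._+_ (trans (ℤ.pos-* (n * h) t) (cong (ℤ._* T) (ℤ.pos-* n h)))
                   (trans (ℤ.pos-* 2 (n * δ)) (cong (+ 2 ℤ.*_) (ℤ.pos-* n δ))))
      (cong₂ ℤ._+_ (ℤ.pos-* n h) (ℤ.pos-* 2 (2 * m)))
      (ℤ.+≤+ le)
    -- The left-hand sides of `lhs` and `rhs` spell out the cross products in the form to which ℚᵘ
    -- arithmetic unfolds.
    lhs : (T ℤ.* + 1 ℤ.+ ℤ.- + 1 ℤ.* + 1) ℤ.* + (1 * (n * 1 * h)) ≡
          N ℤ.* H ℤ.* T ℤ.+ + 2 ℤ.* (N ℤ.* Δ) ℤ.- (N ℤ.* H ℤ.+ + 2 ℤ.* (N ℤ.* Δ))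
    lhs = trans (cong ((T ℤ.* + 1 ℤ.+ ℤ.- + 1 ℤ.* + 1) ℤ.*_) (2xᵘ-denominator n h)) (ring T N H Δ)
      where
      ring : ∀ T N H Δ → (T ℤ.* + 1 ℤ.+ ℤ.- + 1 ℤ.* + 1) ℤ.* (N ℤ.* H) ≡
        N ℤ.* H ℤ.* T ℤ.+ + 2 ℤ.* (N ℤ.* Δ) ℤ.- (N ℤ.* H ℤ.+ + 2 ℤ.* (N ℤ.* Δ))
      ring = ℤ-Solver.solve-∀
    rhs : + 2 ℤ.* ((M ℤ.* + 1 ℤ.+ ℤ.- Δ ℤ.* N) ℤ.* + 1) ℤ.* + 1 ≡
          N ℤ.* H ℤ.+ + 2 ℤ.* M ℤ.- (N ℤ.* H ℤ.+ + 2 ℤ.* (N ℤ.* Δ))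
    rhs = ring M N H Δ
      where
      ring : ∀ M N H Δ → + 2 ℤ.* ((M ℤ.* + 1 ℤ.+ ℤ.- Δ ℤ.* N) ℤ.* + 1) ℤ.* + 1 ≡
        N ℤ.* H ℤ.+ + 2 ℤ.* M ℤ.- (N ℤ.* H ℤ.+ + 2 ℤ.* (N ℤ.* Δ))
      ring = ℤ-Solver.solve-∀
    toℚᵘ-t-1 : ℚ.toℚᵘ (+ t / 1 ℚ.- 1ℚ) ℚᵘ.≃ + t ℚᵘ./ 1 ℚᵘ.- ℚᵘ.1ℚᵘ
    toℚᵘ-t-1 = ℚᵘ.≃-trans (ℚ.toℚᵘ-homo-+ (+ t / 1) (ℚ.- 1ℚ)) (ℚᵘ.+-congˡ (ℚᵘ.- ℚᵘ.1ℚᵘ) (toℚᵘ-/ (+ t) 1))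

  2x≤t : ∀ n .{{_ : NonZero n}} → 2 * (2 * m) ≤ n * h * t + 2 * (n * δ) →
         + 2 / 1 ℚ.* x n m ℚ.≤ + t / 1
  2x≤t n@(suc _) le = ℚ.toℚᵘ-cancel-≤
    (ℚᵘ.≤-respˡ-≃ (ℚᵘ.≃-sym (toℚᵘ-2x n)) (ℚᵘ.≤-respʳ-≃ (ℚᵘ.≃-sym (toℚᵘ-/ (+ t) 1))
      (*≤* (subst₂ ℤ._≤_ (sym lhs) (sym rhs)
        -- Here the shift is by 2nδ alone.
        (ℤ.+-monoˡ-≤ (ℤ.- (+ 2 ℤ.* (N ℤ.* Δ))) le′)))))
    where
    T = + t ; N = + n ; H = + h ; M = + (2 * m) ; Δ = + δ
    le′ : + 2 ℤ.* M ℤ.≤ N ℤ.* H ℤ.* T ℤ.+ + 2 ℤ.* (N ℤ.* Δ)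
    le′ = subst₂ ℤ._≤_
      (ℤ.pos-* 2 (2 * m))
      (cong₂ ℤ._+_ (trans (ℤ.pos-* (n * h) t) (cong (ℤ._* T) (ℤ.pos-* n h)))
                   (trans (ℤ.pos-* 2 (n * δ)) (cong (+ 2 ℤ.*_) (ℤ.pos-* n δ))))
      (ℤ.+≤+ le)
    lhs : + 2 ℤ.* ((M ℤ.* + 1 ℤ.+ ℤ.- Δ ℤ.* N) ℤ.* + 1) ℤ.* + 1 ≡ + 2 ℤ.* M ℤ.- + 2 ℤ.* (N ℤ.* Δ)
    lhs = ring M N Δ
      where
      ring : ∀ M N Δ → + 2 ℤ.* ((M ℤ.* + 1 ℤ.+ ℤ.- Δ ℤ.* N) ℤ.* + 1) ℤ.* + 1 ≡
        + 2 ℤ.* M ℤ.- + 2 ℤ.* (N ℤ.* Δ)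
      ring = ℤ-Solver.solve-∀
    rhs : T ℤ.* + (1 * (n * 1 * h)) ≡
          N ℤ.* H ℤ.* T ℤ.+ + 2 ℤ.* (N ℤ.* Δ) ℤ.- + 2 ℤ.* (N ℤ.* Δ)
    rhs = trans (cong (T ℤ.*_) (2xᵘ-denominator n h)) (ring T N H Δ)
      where
      ring : ∀ T N H Δ → T ℤ.* (N ℤ.* H) ≡
        N ℤ.* H ℤ.* T ℤ.+ + 2 ℤ.* (N ℤ.* Δ) ℤ.- + 2 ℤ.* (N ℤ.* Δ)
      ring = ℤ-Solver.solve-∀

proposition5 :
  (n : ℕ) .{{_ : NonZero n}} (G : Graph n) (k t : ℕ) .{{_ : NonZero t}} →
  let m = size G
      δ = minDegree G
      s = sp G k
      open Intervals δ k
  in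
  ((+ s / 1 ≡ refinedBound G t) ⇔ (∀ i → i < t → W G i ≡ s))
  ×
  ((+ s / 1 ≡ f n m t) ⇔
    ( (∀ v → ∃[ i ] (i ≤ t × deg G v ≡ δ + i * h))
    × (∀ i → i < t → numOfDegree G (δ + i * h) ≡ s)
    × + numOfDegree G (δ + t * h) ≡ + n ℤ.- + (t * s)
    × + n ℤ.- + (t * s) ℤ.≤ + s))
  ×
  (+ s / 1 ≡ f n m t →
    (∃[ z ] f n m t ≡ z / 1)
    × + n / suc t ℚ.≤ + s / 1
    × + s / 1 ℚ.≤ + n / t
    × + t / 1 ℚ.- 1ℚ ℚ.≤ + 2 / 1 ℚ.* x n m
    × + 2 / 1 ℚ.* x n m ℚ.≤ + t / 1)
proposition5 n G k t =
    s≡refinedBound⇔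
  , (mk⇔ tight⇒profile profile⇒tight ⇔-∘ s≡f⇔)
  , λ s≡f → let eq = to s≡f⇔ s≡f in
        (+ s , sym s≡f)
      , /≤/ {n} {s} (suc t) 1 (≤-trans (≤-reflexive (*-identityʳ n))
          (≤-trans (n≤[1+t]s eq) (≤-reflexive (*-comm (suc t) s))))
      , /≤/ {s} {n} 1 t (≤-trans (≤-reflexive (*-comm s t))
          (≤-trans (ts≤n eq) (≤-reflexive (sym (*-identityʳ n)))))
      , t-1≤2x (minDegree G) k (size G) t n (tight⇒nht+2nδ≤nh+4m eq)
      , 2x≤t (minDegree G) k (size G) t n (tight⇒4m≤nht+2nδ eq)
  where
  open Equalities G k t
  s = sp G k
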